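{- Let $\pi$ be a fixed permutation pattern. Every set $X$ of $n$ points in the plane in general position that avoids $\pi$ admits a manhattan network of linear complexity, i.e.\ $\mathsf{OPT^M}(X)=O(n)$, where the constant depends only on $\pi$.
   Context: General position: no two points share an $x$-coordinate or a $y$-coordinate. A point set in general position determines a permutation (the ranks of the $x$-coordinates listed in order of increasing $y$-coordinate); $X$ avoids a permutation $\pi$ of $[k]$ if no $k$ points of $X$ have relative ordering $\pi$. A manhattan path between points $x,y$ with respect to a point set $B$ is a sequence of distinct points $(x=x_1,\dots,x_k=y)$ of $B$ such that consecutive points lie on a common horizontal or vertical line and both the $x$-coordinates and the $y$-coordinates form monotone sequences. A manhattan network for $X$ is a point set $Y\supseteq X$ such that every two points of $X$ are joined by a manhattan path with respect to $Y$; its complexity is $|Y|$, and $\mathsf{OPT^M}(X)$ is the minimum complexity.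
   Formalization: The points of the plane, both those of X and those of the manhattan network, are taken with rational instead of real coordinates. -}

module Defs where

open import Data.Nat using (ℕ; zero; suc)
open import Data.Fin using (Fin; zero; suc; inject₁; fromℕ) renaming (_<_ to _<ᶠ_; _≤_ to _≤ᶠ_)
open import Data.Fin.Permutation using (Permutation′; _⟨$⟩ʳ_)
open import Data.Rational using (ℚ; _<_; _≤_)
open import Data.Product using (_×_; _,_; proj₁; proj₂; Σ; ∃; ∃-syntax)
open import Data.Sum using (_⊎_)
open import Data.List using (List)
open import Data.List.Membership.Propositional using (_∈_)
open import Relation.Binary.PropositionalEquality using (_≡_; _≢_)
open import Function.Definitions using (Injective)

Point : Set
Point = ℚ × ℚ

xc : Point → ℚ
xc = proj₁

yc : Point → ℚ
yc = proj₂

GeneralPosition : List Point → Set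
GeneralPosition X =
  ∀ {p q} → p ∈ X → q ∈ X → p ≢ q → (xc p ≢ xc q) × (yc p ≢ yc q)

Contains : ∀ {k} → Permutation′ k → List Point → Set
Contains {k} π X =
  Σ (Fin k → Point) λ f →
      (∀ i → f i ∈ X)
    × (∀ i j → i <ᶠ j → yc (f i) < yc (f j))
    × (∀ i j → (π ⟨$⟩ʳ i) <ᶠ (π ⟨$⟩ʳ j) → xc (f i) < xc (f j))

Avoids : ∀ {k} → Permutation′ k → List Point → Set
Avoids π X = Contains π X → Data.Empty.⊥
  where import Data.Empty

Monotone : ∀ {m} → (Fin m → ℚ) → Set
Monotone g = (∀ i j → i ≤ᶠ j → g i ≤ g j) ⊎ (∀ i j → i ≤ᶠ j → g j ≤ g i)

ManhattanPath : List Point → Point → Point → Set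
ManhattanPath B a b =
  Σ ℕ λ m → Σ (Fin (suc m) → Point) λ f →
      f zero ≡ a
    × f (fromℕ m) ≡ b
    × Injective _≡_ _≡_ f
    × (∀ i → f i ∈ B)
    × (∀ (i : Fin m) → (xc (f (inject₁ i)) ≡ xc (f (suc i)))
                      ⊎ (yc (f (inject₁ i)) ≡ yc (f (suc i))))
    × Monotone (λ i → xc (f i))
    × Monotone (λ i → yc (f i))

IsManhattanNetwork : List Point → List Point → Set
IsManhattanNetwork X Y =
  (∀ {p} → p ∈ X → p ∈ Y) × (∀ {p q} → p ∈ X → q ∈ X → ManhattanPath Y p q)

{-# OPTIONS --safe #-}
module Submission where

-- Replace coordinates by ranks in [0 , 2 ^ L) and cut the plane into 2 ^ j × 2 ^ j cells for every
-- level j.  Picking a point in each occupied cell shows that the occupied cells of a level form a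
-- π-avoiding 0-1 matrix, so by the Marcus–Tardos theorem there are O(2 ^ (L − j)) of them, which
-- sums to O(n) over all levels.  The network contains a bounded number of points per occupied cell:
-- its corners, and the points needed to continue a monotone path from a corner to the corresponding
-- corner of the enclosing cell.  Thus every point of X has monotone paths to all four corners of all
-- its cells.  Two points p and q are joined at the coarsest level where their cells share neither a row
-- nor a column: one level up they do share one, so the two strips are adjacent, and the facing
-- corners of the two cells lie on the line between them.

open import Defs
open import Data.Nat
open import Data.Nat.Properties
open import Data.Nat.Tactic.RingSolver using (solve-∀)
open import Data.Fin using (Fin; zero; suc; toℕ; fromℕ; fromℕ<; inject₁; finToFun; funToFin) renaming (_<_ to _<ᶠ_; _≤_ to _≤ᶠ_)
open import Data.Fin.Properties using (toℕ<n; toℕ-fromℕ<; any?; all?; finToFun-funToFin) renaming (_<?_ to _<ᶠ?_)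
open import Data.Fin.Permutation using (Permutation′; _⟨$⟩ʳ_)
open import Data.Rational as ℚ using (ℚ)
import Data.Rational.Properties as ℚ
open import Data.Product using (_×_; _,_; proj₁; proj₂; Σ; ∃-syntax; map₂)
open import Data.Product.Properties using (≡-dec)
open import Data.Sum using (_⊎_; inj₁; inj₂) renaming (map to ⊎-map)
open import Data.List using (List; []; _∷_; _++_; map; concat; applyUpTo; length; deduplicate)
open import Data.List.Properties using (length-++; length-map; length-deduplicate)
open import Data.List.Membership.Propositional using (_∈_; find; lose)
open import Data.List.Membership.Propositional.Properties
  using (∈-concat⁺′; ∈-applyUpTo⁺; ∈-map⁺; ∈-++⁺ˡ; ∈-++⁺ʳ; ∈-deduplicate⁺)
open import Data.List.Relation.Binary.Permutation.Propositional using (↭-sym)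
open import Data.List.Relation.Binary.Permutation.Propositional.Properties using (∈-resp-↭; ↭-length)
open import Data.List.Relation.Binary.Subset.Propositional using (_⊆_)
open import Data.List.Relation.Unary.Any as Any using (Any; here; there)
open import Data.List.Relation.Unary.Linked using (_∷_)
open import Data.List.Relation.Unary.Unique.DecPropositional.Properties using (deduplicate-!)
open import Data.List.Relation.Unary.Unique.Propositional using (Unique; [])
open import Data.List.Sort ℚ.≤-decTotalOrder using (sort; sort-↭; sort-↗)
import Data.Vec.Functional as Vector
open import Function using (_∘_; flip)
open import Function.Definitions using (Injective)
open import Relation.Nullary using (Dec; yes; no; ¬_; contradiction; _×-dec_; _→-dec_)
open import Relation.Binary.Bundles using (DecTotalOrder)
open import Relation.Binary.Construct.Closure.ReflexiveTransitive as Star using (Star; ε; _◅_; _◅◅_)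
open import Relation.Binary.Definitions using (DecidableEquality; tri<; tri≈; tri>)
open import Relation.Binary.PropositionalEquality
open import Data.List.Relation.Unary.Sorted.TotalOrder (DecTotalOrder.totalOrder ℚ.≤-decTotalOrder) using (Sorted)
open import Algebra.Properties.CommutativeSemigroup *-commutativeSemigroup using (x∙yz≈y∙xz)
open import Algebra.Properties.Semiring.Sum +-*-semiring
  using (sum; ∑-distrib-+; ∑-comm; sum-cong-≗; *-distribˡ-sum; *-distribʳ-sum)

-- Finite sums.

sum-mono : ∀ {n} {f g : Fin n → ℕ} → (∀ i → f i ≤ g i) → sum f ≤ sum g
sum-mono {zero}  f≤g = z≤n
sum-mono {suc n} f≤g = +-mono-≤ (f≤g zero) (sum-mono (f≤g ∘ suc))

sum-≤-* : ∀ {n K} {f : Fin n → ℕ} → (∀ i → f i ≤ K) → sum f ≤ n * K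
sum-≤-* {zero}  f≤K = z≤n
sum-≤-* {suc n} f≤K = +-mono-≤ (f≤K zero) (sum-≤-* (f≤K ∘ suc))

term≤sum : ∀ {n} (f : Fin n → ℕ) i → f i ≤ sum f
term≤sum f zero    = m≤m+n _ _
term≤sum f (suc i) = ≤-trans (term≤sum (f ∘ suc) i) (m≤n+m _ _)

sum-*-sum : ∀ {m n} (f : Fin m → ℕ) (g : Fin n → ℕ) →
            sum (λ i → sum (λ j → f i * g j)) ≡ sum f * sum g
sum-*-sum f g = trans (sum-cong-≗ (λ i → sym (*-distribˡ-sum (f i) g)))
                      (sym (*-distribʳ-sum (sum g) f))

sumTo : ℕ → (ℕ → ℕ) → ℕ
sumTo n f = sum {n} (f ∘ toℕ)

sumTo-cong : ∀ n {f g : ℕ → ℕ} → (∀ i → f i ≡ g i) → sumTo n f ≡ sumTo n g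
sumTo-cong n f≡g = sum-cong-≗ {n} (f≡g ∘ toℕ)

sumTo-+ : ∀ m {n} f → sumTo (m + n) f ≡ sumTo m f + sumTo n (f ∘ (m +_))
sumTo-+ zero    f = refl
sumTo-+ (suc m) f = trans (cong (f 0 +_) (sumTo-+ m (f ∘ suc))) (sym (+-assoc (f 0) _ _))

sumTo-* : ∀ n s f → sumTo (n * s) f ≡ sumTo n (λ I → sumTo s (λ a → f (I * s + a)))
sumTo-* zero    s f = refl
sumTo-* (suc n) s f = trans (sumTo-+ s f) (cong (sumTo s f +_)
  (trans (sumTo-* n s (f ∘ (s +_)))
         (sumTo-cong n λ I → sumTo-cong s λ a → cong f (sym (+-assoc s (I * s) a)))))

sumTo-mono-range : ∀ {m n} f → m ≤ n → sumTo m f ≤ sumTo n f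
sumTo-mono-range {m} {n} f m≤n with k , refl ← m≤n⇒∃[o]m+o≡n m≤n =
  ≤-trans (m≤m+n _ _) (≤-reflexive (sym (sumTo-+ m f)))

-- Counting with indicators, and the pigeonhole for bicliques.

⟦_⟧ : ∀ {a} {A : Set a} → Dec A → ℕ
⟦ yes _ ⟧ = 1
⟦ no  _ ⟧ = 0

⟦⟧≤1 : ∀ {a} {A : Set a} (A? : Dec A) → ⟦ A? ⟧ ≤ 1
⟦⟧≤1 (yes _) = ≤-refl
⟦⟧≤1 (no  _) = z≤n

⟦⟧≡1 : ∀ {a} {A : Set a} (A? : Dec A) → A → ⟦ A? ⟧ ≡ 1
⟦⟧≡1 (yes _) a = refl
⟦⟧≡1 (no ¬a) a = contradiction a ¬a

⟦⟧-≤ : ∀ {a} {A : Set a} (A? : Dec A) {n} → (A → 1 ≤ n) → ⟦ A? ⟧ ≤ n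
⟦⟧-≤ (yes a) h = h a
⟦⟧-≤ (no _)  h = z≤n

Increasing : ∀ {k} → (Fin k → ℕ) → Set
Increasing f = ∀ i j → i <ᶠ j → f i < f j

-- Scanning the indices upwards from 0 yields them in increasing order. This turns a lower bound on
-- a count into the increasing tuples that patterns are made of.
select : ∀ {P : ℕ → Set} (P? : ∀ i → Dec (P i)) k n → k ≤ sumTo n (⟦_⟧ ∘ P?) →
         ∃[ f ] Increasing {k} f × (∀ i → f i < n) × (∀ i → P (f i))
select P? zero    n       k≤ = (λ ()) , (λ ()) , (λ ()) , (λ ())
select P? (suc k) (suc n) k≤ with P? 0
... | no _ with f , f↑ , f<n , Pf ← select (P? ∘ suc) (suc k) n k≤ =
  suc ∘ f , (λ i j i<j → s≤s (f↑ i j i<j)) , s≤s ∘ f<n , Pf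
... | yes P0 with f , f↑ , f<n , Pf ← select (P? ∘ suc) k n (s≤s⁻¹ k≤) =
  (λ { zero → 0 ; (suc i) → suc (f i) }) ,
  (λ { zero (suc j) _ → z<s ; (suc i) (suc j) i<j → s≤s (f↑ i j (s≤s⁻¹ i<j)) }) ,
  (λ { zero → z<s ; (suc i) → s≤s (f<n i) }) ,
  (λ { zero → P0 ; (suc i) → Pf i })

-- Pigeonhole over the s ^ k candidate tuples S (the Kővári–Sós–Turán argument).
module _ {O : ℕ → ℕ → Set} (O? : ∀ t a → Dec (O t a)) (k s : ℕ) where
  private
    tuple : Fin (s ^ k) → Fin k → ℕ
    tuple c = toℕ ∘ finToFun c

    Common : Fin (s ^ k) → ℕ → Set
    Common c t = Increasing (tuple c) × (∀ j → O t (tuple c j))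

    Common? : ∀ c t → Dec (Common c t)
    Common? c t = (all? λ i → all? λ j → (i <ᶠ? j) →-dec (tuple c i <? tuple c j))
                  ×-dec (all? λ j → O? t (tuple c j))

    covered : ∀ t → k ≤ sumTo s (⟦_⟧ ∘ O? t) → 1 ≤ sum (λ c → ⟦ Common? c t ⟧)
    covered t k≤ with f , f↑ , f<s , Of ← select (O? t) k s k≤ =
      ≤-trans (≤-reflexive (sym (⟦⟧≡1 (Common? c t)
        ( (λ i j i<j → subst₂ _<_ (sym (val i)) (sym (val j)) (f↑ i j i<j))
        , (λ j → subst (O t) (sym (val j)) (Of j))))))
        (term≤sum _ c)
      where
      c = funToFin (λ i → fromℕ< (f<s i))
      val : ∀ i → tuple c i ≡ f i
      val i = trans (cong toℕ (finToFun-funToFin (λ i → fromℕ< (f<s i)) i)) (toℕ-fromℕ< (f<s i))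

  biclique : ∀ {n} → 0 < k → s ^ k * k < sumTo n (λ t → ⟦ k ≤? sumTo s (⟦_⟧ ∘ O? t) ⟧) →
             ∃[ T ] ∃[ S ] Increasing {k} T × Increasing {k} S × (∀ i j → O (T i) (S j))
  biclique {n} 0<k big with any? (λ c → k <? sumTo n (λ t → ⟦ Common? c t ⟧))
  ... | yes (c , many) with T , T↑ , _ , common ← select (Common? c) k n (<⇒≤ many) =
    -- Monotonicity of the tuple is stored in each `Common c t`, so one of the selected `t` is
    -- needed to read it off; `0<k` supplies it.
    T , tuple c , T↑ , proj₁ (common (fromℕ< 0<k)) , proj₂ ∘ common
  ... | no ¬many = contradiction big (≤⇒≯ (begin
    sumTo n (λ t → ⟦ k ≤? sumTo s (⟦_⟧ ∘ O? t) ⟧)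
      ≤⟨ sum-mono {n} (λ t → ⟦⟧-≤ (k ≤? sumTo s (⟦_⟧ ∘ O? (toℕ t))) (covered (toℕ t))) ⟩
    sumTo n (λ t → sum (λ c → ⟦ Common? c t ⟧))
      ≡⟨ ∑-comm {n} (λ t c → ⟦ Common? c (toℕ t) ⟧) ⟩
    sum (λ c → sumTo n (λ t → ⟦ Common? c t ⟧))
      ≤⟨ sum-≤-* (λ c → ≮⇒≥ (λ lt → ¬many (c , lt))) ⟩
    s ^ k * k ∎))
    where open ≤-Reasoning

-- Double sums over square grids.

sumGrid : ℕ → (ℕ → ℕ → ℕ) → ℕ
sumGrid n f = sumTo n (λ i → sumTo n (f i))

ones : ∀ {M : ℕ → ℕ → Set} → (∀ i j → Dec (M i j)) → ℕ → ℕ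
ones M? n = sumGrid n (λ i j → ⟦ M? i j ⟧)

sumGrid-mono : ∀ n {f g : ℕ → ℕ → ℕ} → (∀ i j → f i j ≤ g i j) → sumGrid n f ≤ sumGrid n g
sumGrid-mono n f≤g = sum-mono {n} (λ i → sum-mono {n} (λ j → f≤g (toℕ i) (toℕ j)))

sumGrid-mono-range : ∀ {m n} (f : ℕ → ℕ → ℕ) → m ≤ n → sumGrid m f ≤ sumGrid n f
sumGrid-mono-range {m} {n} f m≤n = ≤-trans
  (sum-mono {m} (λ i → sumTo-mono-range (f (toℕ i)) m≤n))
  (sumTo-mono-range (λ i → sumTo n (f i)) m≤n)

sumGrid-+ : ∀ n (f g : ℕ → ℕ → ℕ) →
            sumGrid n (λ i j → f i j + g i j) ≡ sumGrid n f + sumGrid n g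
sumGrid-+ n f g = trans
  (sumTo-cong n (λ i → ∑-distrib-+ {n} (f i ∘ toℕ) (g i ∘ toℕ)))
  (∑-distrib-+ {n} (λ i → sumTo n (f (toℕ i))) (λ i → sumTo n (g (toℕ i))))

sumGrid-*ˡ : ∀ n c (f : ℕ → ℕ → ℕ) → sumGrid n (λ i j → c * f i j) ≡ c * sumGrid n f
sumGrid-*ˡ n c f = trans
  (sumTo-cong n (λ i → sym (*-distribˡ-sum {n} c (f i ∘ toℕ))))
  (sym (*-distribˡ-sum {n} c (λ i → sumTo n (f (toℕ i)))))

sumGrid-* : ∀ n s f → sumGrid (n * s) f ≡
            sumGrid n (λ I J → sumGrid s (λ a b → f (I * s + a) (J * s + b)))
sumGrid-* n s f = begin
  sumTo (n * s) (λ i → sumTo (n * s) (f i))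
    ≡⟨ sumTo-* n s (λ i → sumTo (n * s) (f i)) ⟩
  sumTo n (λ I → sumTo s (λ a → sumTo (n * s) (f (I * s + a))))
    ≡⟨ sumTo-cong n (λ I → sumTo-cong s (λ a → sumTo-* n s (f (I * s + a)))) ⟩
  sumTo n (λ I → sumTo s (λ a → sumTo n (λ J → sumTo s (λ b → f (I * s + a) (J * s + b)))))
    ≡⟨ sumTo-cong n (λ I → ∑-comm {s} {n} (λ a J →
         sumTo s (λ b → f (I * s + toℕ a) (toℕ J * s + b)))) ⟩
  sumGrid n (λ I J → sumGrid s (λ a b → f (I * s + a) (J * s + b))) ∎
  where open ≡-Reasoning

-- The Marcus-Tardos theorem.

-- The first index plays the x-coordinate and the second the y-coordinate, to match `Contains`.
MatrixContains : ∀ {k} → (Fin k → Fin k) → (ℕ → ℕ → Set) → Set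
MatrixContains {k} σ M = Σ (Fin k → ℕ) λ u → Σ (Fin k → ℕ) λ v → (∀ i → M (u i) (v i))
  × Increasing v × (∀ i j → σ i <ᶠ σ j → u i < u j)

module MarcusTardos {k : ℕ} (σ : Fin k → Fin k) (0<k : 0 < k) (s : ℕ) where

  Blocks : (ℕ → ℕ → Set) → ℕ → ℕ → Set
  Blocks M I J = ∃[ a ] a < s × ∃[ b ] b < s × M (I * s + a) (J * s + b)

  Column : (ℕ → ℕ → Set) → ℕ → ℕ → ℕ → Set
  Column M I J a = ∃[ b ] b < s × M (I * s + a) (J * s + b)

  module _ {M : ℕ → ℕ → Set} (M? : ∀ i j → Dec (M i j)) where

    column? : ∀ I J a → Dec (Column M I J a)
    column? I J a = anyUpTo? (λ b → M? (I * s + a) (J * s + b)) s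

    blocks? : ∀ I J → Dec (Blocks M I J)
    blocks? I J = anyUpTo? (column? I J) s

    -- Applied to `flip M?` with the block indices exchanged, the same test detects tall blocks,
    -- those with at least `k` nonempty rows.
    wide? : ∀ I J → Dec (k ≤ sumTo s (⟦_⟧ ∘ column? I J))
    wide? I J = k ≤? sumTo s (⟦_⟧ ∘ column? I J)

  module _ {M : ℕ → ℕ → Set} (M? : ∀ i j → Dec (M i j)) where

    private
      Mᵀ? = flip M?

      blockSum : ℕ → ℕ → ℕ
      blockSum I J = sumGrid s (λ a b → ⟦ M? (I * s + a) (J * s + b) ⟧)

    blockSum≤s² : ∀ I J → blockSum I J ≤ s * s
    blockSum≤s² I J = sum-≤-* {s} (λ a → ≤-trans
      (sum-≤-* {s} (λ b → ⟦⟧≤1 (M? (I * s + toℕ a) (J * s + toℕ b)))) (≤-reflexive (*-identityʳ s)))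

    -- A one at `(a , b)` makes both column `a` and row `b` of the block nonempty, so its indicator
    -- is at most the product of theirs.
    blockSum≤columns*rows : ∀ I J → blockSum I J ≤
      sumTo s (⟦_⟧ ∘ column? M? I J) * sumTo s (⟦_⟧ ∘ column? Mᵀ? J I)
    blockSum≤columns*rows I J = ≤-trans
      (sum-mono {s} (λ a → sum-mono {s} (λ b →
        ⟦⟧-≤ (M? (I * s + toℕ a) (J * s + toℕ b)) (λ Mab → ≤-reflexive (sym (cong₂ _*_
        (⟦⟧≡1 (column? M? I J (toℕ a)) (toℕ b , toℕ<n b , Mab))
        (⟦⟧≡1 (column? Mᵀ? J I (toℕ b)) (toℕ a , toℕ<n a , Mab))))))))
      (≤-reflexive (sum-*-sum {s} {s} (⟦_⟧ ∘ column? M? I J ∘ toℕ) (⟦_⟧ ∘ column? Mᵀ? J I ∘ toℕ)))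

    blockSum-empty : ∀ I J → ¬ Blocks M I J → blockSum I J ≤ 0
    blockSum-empty I J empty = ≤-trans
      (sum-≤-* {s} {0} (λ a → ≤-trans (sum-≤-* {s} {0} (λ b →
        ⟦⟧-≤ (M? (I * s + toℕ a) (J * s + toℕ b)) (λ Mab → contradiction (toℕ a , toℕ<n a , toℕ b , toℕ<n b , Mab) empty)))
        (≤-reflexive (*-zeroʳ s))))
      (≤-reflexive (*-zeroʳ s))

    -- The recursion step of Marcus and Tardos: a block with at least k nonempty columns or at least
    -- k nonempty rows is rare, and any other block has at most k * k ones.
    blockSum-≤ : ∀ I J → blockSum I J ≤ k * k * ⟦ blocks? M? I J ⟧ +
      (s * s * ⟦ wide? M? I J ⟧ + s * s * ⟦ wide? Mᵀ? J I ⟧)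
    blockSum-≤ I J with wide? M? I J | wide? Mᵀ? J I | blocks? M? I J
    ... | yes _ | t | b = ≤-trans (≤-trans (blockSum≤s² I J) (≤-reflexive (sym (*-identityʳ _))))
      (≤-trans (m≤m+n (s * s * 1) (s * s * ⟦ t ⟧)) (m≤n+m _ (k * k * ⟦ b ⟧)))
    ... | no _ | yes _ | b = ≤-trans (≤-trans (blockSum≤s² I J) (≤-reflexive (sym (*-identityʳ _))))
      (≤-trans (m≤n+m (s * s * 1) (s * s * 0)) (m≤n+m _ (k * k * ⟦ b ⟧)))
    ... | no _ | no _ | no empty = ≤-trans (blockSum-empty I J empty) z≤n
    ... | no ¬w | no ¬t | yes _ = ≤-trans (≤-trans (blockSum≤columns*rows I J)
                                    (*-mono-≤ (≰⇒≥ ¬w) (≰⇒≥ ¬t)))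
                                    (≤-trans (≤-reflexive (sym (*-identityʳ _))) (m≤m+n _ _))

  block-< : ∀ {I J} a b → I < J → a < s → I * s + a < J * s + b
  block-< {I} {J} a b I<J a<s = begin-strict
    I * s + a  <⟨ +-monoʳ-< (I * s) a<s ⟩
    I * s + s  ≡⟨ +-comm (I * s) s ⟩
    suc I * s  ≤⟨ *-monoˡ-≤ s I<J ⟩
    J * s      ≤⟨ m≤m+n _ b ⟩
    J * s + b  ∎
    where open ≤-Reasoning

  -- Cost per strip of blocks: at most `s ^ k * k` exceptional blocks with at most `s * s` ones
  -- each, once for wide blocks and once for tall ones.
  C : ℕ
  C = s * s * (s ^ k * k) + s * s * (s ^ k * k)

  module _ {M : ℕ → ℕ → Set} (M? : ∀ i j → Dec (M i j)) (avoids : ¬ MatrixContains σ M) where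

    -- Picking a one in every block of an occurrence keeps all strict inequalities, because offsets
    -- inside a block stay below `s`.
    blocks-avoid : ¬ MatrixContains σ (Blocks M)
    blocks-avoid (u , v , Muv , v↑ , u↑) = avoids
      ( (λ i → u i * s + proj₁ (Muv i))
      , (λ i → v i * s + proj₁ (proj₂ (proj₂ (Muv i))))
      , (λ i → proj₂ (proj₂ (proj₂ (proj₂ (Muv i)))))
      , (λ i j i<j → block-< _ _ (v↑ i j i<j) (proj₁ (proj₂ (proj₂ (proj₂ (Muv i))))))
      , (λ i j i<j → block-< _ _ (u↑ i j i<j) (proj₁ (proj₂ (Muv i)))))

    -- Too many wide blocks would give `k` of them with `k` common nonempty columns. These contain
    -- every pattern: the one for `i` is taken in block `T i` and column `S (σ i)`.
    few-wide : ∀ n I → sumTo n (λ J → ⟦ wide? M? I J ⟧) ≤ s ^ k * k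
    few-wide n I = ≮⇒≥ λ big →
      let T , S , T↑ , S↑ , O = biclique (λ J → column? M? I J) k s {n} 0<k big in avoids
      ( (λ i → I * s + S (σ i))
      , (λ i → T i * s + proj₁ (O i (σ i)))
      , (λ i → proj₂ (proj₂ (O i (σ i))))
      , (λ i j i<j → block-< _ _ (T↑ i j i<j) (proj₁ (proj₂ (O i (σ i)))))
      , (λ i j i<j → +-monoʳ-< (I * s) (S↑ _ _ i<j)))

    few-tall : ∀ n J → sumTo n (λ I → ⟦ wide? (flip M?) J I ⟧) ≤ s ^ k * k
    few-tall n J = ≮⇒≥ λ big →
      let T , S , T↑ , S↑ , O = biclique (λ I → column? (flip M?) J I) k s {n} 0<k big in avoids
      -- The blocks now follow one another in the first coordinate, so `σ i` picks the block and `i`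
      -- the row.
      ( (λ i → T (σ i) * s + proj₁ (O (σ i) i))
      , (λ i → J * s + S i)
      , (λ i → proj₂ (proj₂ (O (σ i) i)))
      , (λ i j i<j → +-monoʳ-< (J * s) (S↑ _ _ i<j))
      , (λ i j i<j → block-< _ _ (T↑ _ _ i<j) (proj₁ (proj₂ (O (σ i) i)))))

    ones-blocks : ∀ n → ones M? (n * s) ≤ k * k * ones (blocks? M?) n + C * n
    ones-blocks n = begin
      ones M? (n * s)
        ≡⟨ sumGrid-* n s (λ i j → ⟦ M? i j ⟧) ⟩
      sumGrid n (λ I J → sumGrid s (λ a b → ⟦ M? (I * s + a) (J * s + b) ⟧))
        ≤⟨ sumGrid-mono n (blockSum-≤ M?) ⟩
      sumGrid n (λ I J → k * k * B I J +
                         (s * s * W I J + s * s * T I J))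
        ≡⟨ trans (sumGrid-+ n (λ I J → k * k * B I J) (λ I J → s * s * W I J + s * s * T I J))
             (cong₂ _+_ (sumGrid-*ˡ n (k * k) B)
               (trans (sumGrid-+ n (λ I J → s * s * W I J) (λ I J → s * s * T I J))
                      (cong₂ _+_ (sumGrid-*ˡ n (s * s) W) (sumGrid-*ˡ n (s * s) T)))) ⟩
      k * k * ones (blocks? M?) n +
        (s * s * sumGrid n (λ I J → W I J) +
         s * s * sumGrid n (λ I J → T I J))
        -- Tall blocks are rare for each fixed `J`, so their sum has to run over `I` first.
        ≡⟨ cong (λ h → k * k * ones (blocks? M?) n +
                         (s * s * sumGrid n (λ I J → W I J) + s * s * h))
             (∑-comm {n} {n} (λ I J → T (toℕ I) (toℕ J))) ⟩
      k * k * ones (blocks? M?) n +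
        (s * s * sumGrid n (λ I J → W I J) +
         s * s * sumGrid n (λ J I → T I J))
        ≤⟨ +-monoʳ-≤ (k * k * ones (blocks? M?) n) (+-mono-≤
             (*-monoʳ-≤ (s * s) (sum-≤-* {n} (λ I → few-wide n (toℕ I))))
             (*-monoʳ-≤ (s * s) (sum-≤-* {n} (λ J → few-tall n (toℕ J))))) ⟩
      k * k * ones (blocks? M?) n + (s * s * (n * (s ^ k * k)) + s * s * (n * (s ^ k * k)))
        ≡⟨ cong (k * k * ones (blocks? M?) n +_) (regroup (s * s) n (s ^ k * k)) ⟩
      k * k * ones (blocks? M?) n + C * n ∎
      where
      open ≤-Reasoning
      B W T : ℕ → ℕ → ℕ
      B I J = ⟦ blocks? M? I J ⟧
      W I J = ⟦ wide? M? I J ⟧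
      T I J = ⟦ wide? (flip M?) J I ⟧
      regroup : ∀ x n y → x * (n * y) + x * (n * y) ≡ (x * y + x * y) * n
      regroup = solve-∀

  -- The induction closes because `k * k` copies of the bound plus one more make `suc (k * k)`,
  -- which is at most `s`. Taking `suc C` keeps the constant positive for the matrix with one entry.
  ones-power : k * k < s → ∀ {M : ℕ → ℕ → Set} (M? : ∀ i j → Dec (M i j)) → ¬ MatrixContains σ M →
               ∀ t → ones M? (s ^ t) ≤ suc C * s ^ t
  ones-power k²<s M? avoids zero = ≤-trans
    (≤-trans (≤-reflexive (trans (+-identityʳ _) (+-identityʳ _))) (⟦⟧≤1 (M? 0 0)))
    (s≤s z≤n)
  ones-power k²<s M? avoids (suc t) = begin
    ones M? (s * s ^ t)
      ≡⟨ cong (ones M?) (*-comm s (s ^ t)) ⟩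
    ones M? (s ^ t * s)
      ≤⟨ ones-blocks M? avoids (s ^ t) ⟩
    k * k * ones (blocks? M?) (s ^ t) + C * s ^ t
      ≤⟨ +-mono-≤ (*-monoʳ-≤ (k * k) (ones-power k²<s (blocks? M?) (blocks-avoid M? avoids) t))
                  (*-monoˡ-≤ (s ^ t) (n≤1+n C)) ⟩
    k * k * (suc C * s ^ t) + suc C * s ^ t
      ≡⟨ +-comm (k * k * (suc C * s ^ t)) _ ⟩
    suc (k * k) * (suc C * s ^ t)
      ≤⟨ *-monoˡ-≤ (suc C * s ^ t) k²<s ⟩
    s * (suc C * s ^ t)
      ≡⟨ x∙yz≈y∙xz s (suc C) (s ^ t) ⟩
    suc C * (s * s ^ t) ∎
    where open ≤-Reasoning

-- The power found for `n - 1` either still suffices or is below `n`, and then one more factor `s`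
-- is affordable. It serves to pad matrices to side `s ^ t` and, with base 2, to fix the number of
-- levels.
power-above : ∀ s n → 2 ≤ s → 1 ≤ n → ∃[ t ] n ≤ s ^ t × s ^ t ≤ s * n
power-above s (suc zero) 2≤s _ = 0 , ≤-refl , ≤-trans (<⇒≤ 2≤s) (≤-reflexive (sym (*-identityʳ s)))
power-above s n@(suc m@(suc _)) 2≤s _ with power-above s m 2≤s (s≤s z≤n)
... | t , m≤sᵗ , sᵗ≤sm with n ≤? s ^ t
...   | yes n≤sᵗ = t , n≤sᵗ , ≤-trans sᵗ≤sm (*-monoʳ-≤ s (n≤1+n m))
...   | no n≰sᵗ =
  suc t ,
  -- Here `m` is positive, so `n` is at most `2 * m`.
  ≤-trans (+-mono-≤ {1} (s≤s z≤n) (m≤m+n m 0)) (*-mono-≤ 2≤s m≤sᵗ) ,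
  *-monoʳ-≤ s (<⇒≤ (≰⇒> n≰sᵗ))

-- Padding `n` to a power of `s` costs the extra factor `s` in the constant.
marcusTardos : ∀ {k} (σ : Fin k → Fin k) → 0 < k →
  ∃[ c ] (∀ {M : ℕ → ℕ → Set} (M? : ∀ i j → Dec (M i j)) → ¬ MatrixContains σ M →
          ∀ n → ones M? n ≤ c * n)
marcusTardos {k} σ 0<k = suc C * s , bound
  where
  -- Blocks wider than k * k make the recursion of ones-blocks contract.
  s = 2 + k * k
  open MarcusTardos σ 0<k s
  bound : ∀ {M : ℕ → ℕ → Set} (M? : ∀ i j → Dec (M i j)) → ¬ MatrixContains σ M →
          ∀ n → ones M? n ≤ suc C * s * n
  bound M? avoids zero = z≤n
  bound M? avoids n@(suc _) with t , n≤sᵗ , sᵗ≤sn ← power-above s n (s≤s (s≤s z≤n)) (s≤s z≤n) = begin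
    ones M? n           ≤⟨ sumGrid-mono-range (λ i j → ⟦ M? i j ⟧) n≤sᵗ ⟩
    ones M? (s ^ t)     ≤⟨ ones-power (n≤1+n _) M? avoids t ⟩
    suc C * s ^ t       ≤⟨ *-monoʳ-≤ (suc C) sᵗ≤sn ⟩
    suc C * (s * n)     ≡⟨ *-assoc (suc C) s n ⟨
    suc C * s * n       ∎
    where open ≤-Reasoning

-- Directed monotone paths.

-- One direction per axis lets a single argument serve all four quadrants.
data Dir : Set where
  up down : Dir

opp : Dir → Dir
opp up   = down
opp down = up

directed : ∀ {a} {A : Set a} → (A → A → Set) → Dir → A → A → Set
directed R up   x y = R x y
directed R down x y = R y x

infix 4 _≤[_]_
_≤[_]_ : ℚ → Dir → ℚ → Set
x ≤[ d ] y = directed ℚ._≤_ d x y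

≤[]-reflexive : ∀ d {x y} → x ≡ y → x ≤[ d ] y
≤[]-reflexive up   refl = ℚ.≤-refl
≤[]-reflexive down refl = ℚ.≤-refl

≤[]-trans : ∀ d {x y z} → x ≤[ d ] y → y ≤[ d ] z → x ≤[ d ] z
≤[]-trans up   p q = ℚ.≤-trans p q
≤[]-trans down p q = ℚ.≤-trans q p

≤[]-antisym : ∀ d {x y} → x ≤[ d ] y → y ≤[ d ] x → x ≡ y
≤[]-antisym up   p q = ℚ.≤-antisym p q
≤[]-antisym down p q = ℚ.≤-antisym q p

opp-opp : ∀ d → opp (opp d) ≡ d
opp-opp up   = refl
opp-opp down = refl

≤[]-opp : ∀ d {x y} → x ≤[ d ] y → y ≤[ opp d ] x
≤[]-opp up   p = p
≤[]-opp down p = p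

-- Steps between equal points are allowed, since corners and elbows of nested cells may coincide;
-- `directedPath` drops them.
record Step (B : List Point) (dx dy : Dir) (u v : Point) : Set where
  constructor step
  field
    source∈ : u ∈ B
    target∈ : v ∈ B
    aligned : xc u ≡ xc v ⊎ yc u ≡ yc v
    x-step  : xc u ≤[ dx ] xc v
    y-step  : yc u ≤[ dy ] yc v

Path : List Point → Dir → Dir → Point → Point → Set
Path B dx dy = Star (Step B dx dy)

reversePath : ∀ {B dx dy u v} → Path B dx dy u v → Path B (opp dx) (opp dy) v u
reversePath {dx = dx} {dy} = Star.reverse λ (step u∈ v∈ al x≤ y≤) →
  step v∈ u∈ (⊎-map sym sym al) (≤[]-opp dx x≤) (≤[]-opp dy y≤)

_≟ᴾ_ : DecidableEquality Point
_≟ᴾ_ = ≡-dec ℚ._≟_ ℚ._≟_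

-- `ManhattanPath` with both directions fixed: when a path is extended at its start, the rest must
-- be known to run in the same direction.
DirectedManhattanPath : List Point → Dir → Dir → Point → Point → Set
DirectedManhattanPath B dx dy a b =
  Σ ℕ λ m → Σ (Fin (suc m) → Point) λ f →
      f zero ≡ a
    × f (fromℕ m) ≡ b
    × Injective _≡_ _≡_ f
    × (∀ i → f i ∈ B)
    × (∀ (i : Fin m) → (xc (f (inject₁ i)) ≡ xc (f (suc i)))
                      ⊎ (yc (f (inject₁ i)) ≡ yc (f (suc i))))
    × (∀ i j → i ≤ᶠ j → xc (f i) ≤[ dx ] xc (f j))
    × (∀ i j → i ≤ᶠ j → yc (f i) ≤[ dy ] yc (f j))

-- Once repetitions of consecutive points are skipped, monotonicity makes the points distinct.
directedPath : ∀ {B dx dy u v} → u ∈ B → Path B dx dy u v → DirectedManhattanPath B dx dy u v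
directedPath {dx = dx} {dy} {u} u∈ ε =
  0 , (λ _ → u) , refl , refl , (λ { {zero} {zero} _ → refl }) , (λ _ → u∈) , (λ ()) ,
  (λ _ _ _ → ≤[]-reflexive dx refl) , (λ _ _ _ → ≤[]-reflexive dy refl)
directedPath {B} {dx} {dy} {u} u∈ (_◅_ {j = w} (step _ w∈ al x≤ y≤) path)
  with directedPath w∈ path | u ≟ᴾ w
... | walk | yes refl = walk
... | m , f , refl , f-end , f-inj , f∈ , f-al , f-x , f-y | no u≢w =
  suc m , g , refl , f-end , g-inj , g∈ , g-al , g-x , g-y
  where
  g : Fin (suc (suc m)) → Point
  g = u Vector.∷ f

  x-from-u : ∀ i → xc u ≤[ dx ] xc (f i)
  x-from-u i = ≤[]-trans dx x≤ (f-x zero i z≤n)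

  y-from-u : ∀ i → yc u ≤[ dy ] yc (f i)
  y-from-u i = ≤[]-trans dy y≤ (f-y zero i z≤n)

  u∉f : ∀ i → u ≢ f i
  u∉f i refl = u≢w (cong₂ _,_ (≤[]-antisym dx x≤ (f-x zero i z≤n))
                              (≤[]-antisym dy y≤ (f-y zero i z≤n)))

  g-inj : Injective _≡_ _≡_ g
  g-inj {zero}  {zero}  _  = refl
  g-inj {zero}  {suc j} eq = contradiction eq (u∉f j)
  g-inj {suc i} {zero}  eq = contradiction (sym eq) (u∉f i)
  g-inj {suc i} {suc j} eq = cong suc (f-inj eq)

  g∈ : ∀ i → g i ∈ B
  g∈ zero    = u∈
  g∈ (suc i) = f∈ i

  g-al : ∀ i → (xc (g (inject₁ i)) ≡ xc (g (suc i))) ⊎ (yc (g (inject₁ i)) ≡ yc (g (suc i)))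
  g-al zero    = al
  g-al (suc i) = f-al i

  g-x : ∀ i j → i ≤ᶠ j → xc (g i) ≤[ dx ] xc (g j)
  g-x zero    zero    _   = ≤[]-reflexive dx refl
  g-x zero    (suc j) _   = x-from-u j
  g-x (suc i) (suc j) i≤j = f-x i j (s≤s⁻¹ i≤j)

  g-y : ∀ i j → i ≤ᶠ j → yc (g i) ≤[ dy ] yc (g j)
  g-y zero    zero    _   = ≤[]-reflexive dy refl
  g-y zero    (suc j) _   = y-from-u j
  g-y (suc i) (suc j) i≤j = f-y i j (s≤s⁻¹ i≤j)

directed⇒Monotone : ∀ d {m} {g : Fin m → ℚ} → (∀ i j → i ≤ᶠ j → g i ≤[ d ] g j) → Monotone g
directed⇒Monotone up   = inj₁
directed⇒Monotone down = inj₂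

manhattanPath : ∀ {B dx dy u v} → u ∈ B → Path B dx dy u v → ManhattanPath B u v
manhattanPath {dx = dx} {dy} u∈ path
  with m , f , f-start , f-end , f-inj , f∈ , f-al , f-x , f-y ← directedPath u∈ path =
  m , f , f-start , f-end , f-inj , f∈ , f-al , directed⇒Monotone dx f-x , directed⇒Monotone dy f-y

ManhattanPath-mono : ∀ {B B′ a b} → B ⊆ B′ → ManhattanPath B a b → ManhattanPath B′ a b
ManhattanPath-mono B⊆B′ (m , f , f-start , f-end , f-inj , f∈ , rest) =
  m , f , f-start , f-end , f-inj , B⊆B′ ∘ f∈ , rest

-- Ranks of coordinates.

-- Past the end of the list, nth returns the last element, which keeps it monotone.
nth : ℚ → List ℚ → ℕ → ℚ
nth x xs       zero    = x
nth x []       (suc i) = x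
nth x (y ∷ xs) (suc i) = nth y xs i

head≤nth : ∀ {x xs} → Sorted (x ∷ xs) → ∀ i → x ℚ.≤ nth x xs i
head≤nth              xs↗         zero    = ℚ.≤-refl
head≤nth {xs = []}    xs↗         (suc i) = ℚ.≤-refl
head≤nth {xs = _ ∷ _} (x≤y ∷ xs↗) (suc i) = ℚ.≤-trans x≤y (head≤nth xs↗ i)

nth-mono : ∀ {x xs} → Sorted (x ∷ xs) → ∀ {i j} → i ≤ j → nth x xs i ℚ.≤ nth x xs j
nth-mono              xs↗       {j = j} z≤n   = head≤nth xs↗ j
nth-mono {xs = []}    xs↗       (s≤s i≤j)     = ℚ.≤-refl
nth-mono {xs = _ ∷ _} (_ ∷ xs↗) (s≤s i≤j)     = nth-mono xs↗ i≤j

position : ℚ → List ℚ → ℕ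
position v []       = 0
position v (x ∷ xs) with x ℚ.≟ v
... | yes _ = 0
... | no  _ = suc (position v xs)

position-< : ∀ {v xs} → v ∈ xs → position v xs < length xs
position-< {v} {x ∷ xs} v∈ with x ℚ.≟ v | v∈
... | yes _  | _         = z<s
... | no x≢v | here refl = contradiction refl x≢v
... | no _   | there v∈′ = s≤s (position-< v∈′)

nth-position : ∀ {v x xs} → v ∈ x ∷ xs → nth x xs (position v (x ∷ xs)) ≡ v
nth-position {v} {x} {xs} v∈ with x ℚ.≟ v
nth-position             v∈         | yes x≡v = x≡v
nth-position             (here refl) | no x≢v = contradiction refl x≢v
nth-position {xs = _ ∷ _} (there v∈) | no _   = nth-position v∈

-- `value` is total and only weakly monotone, so that grid lines beyond the largest rank also have a
-- coordinate.
record Ranking (vs : List ℚ) : Set where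
  field
    rank       : ℚ → ℕ
    value      : ℕ → ℚ
    value-mono : ∀ {i j} → i ≤ j → value i ℚ.≤ value j
    value-rank : ∀ {v} → v ∈ vs → value (rank v) ≡ v
    rank-<     : ∀ {v} → v ∈ vs → rank v < length vs

ranking : ∀ vs → Ranking vs
ranking vs with sort vs | sort-↭ vs | sort-↗ vs
... | []     | vs′↭vs | _ = record
  { rank = λ _ → 0 ; value = λ _ → ℚ.0ℚ ; value-mono = λ _ → ℚ.≤-refl
  ; value-rank = λ v∈ → contradiction (∈-resp-↭ (↭-sym vs′↭vs) v∈) λ ()
  ; rank-< = λ v∈ → contradiction (∈-resp-↭ (↭-sym vs′↭vs) v∈) λ () }
... | x ∷ xs | vs′↭vs | xs↗ = record
  { rank = λ v → position v (x ∷ xs) ; value = nth x xs ; value-mono = nth-mono xs↗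
  ; value-rank = λ v∈ → nth-position (∈-resp-↭ (↭-sym vs′↭vs) v∈)
  ; rank-< = λ v∈ → subst (_ <_) (↭-length vs′↭vs) (position-< (∈-resp-↭ (↭-sym vs′↭vs) v∈)) }

-- Dyadic strips and their boundary lines.

-- This is `x` divided by `2 ^ j`, rounded down. Iterated halving makes the enclosing strip `⌊_/2⌋`
-- by definition.
cell : ℕ → ℕ → ℕ
cell zero    x = x
cell (suc j) x = ⌊ cell j x /2⌋

cell-mono : ∀ j {x y} → x ≤ y → cell j x ≤ cell j y
cell-mono zero    x≤y = x≤y
cell-mono (suc j) x≤y = ⌊n/2⌋-mono (cell-mono j x≤y)

cell-cancel-< : ∀ j {x y} → cell j x < cell j y → x < y
cell-cancel-< j c<c′ = ≰⇒> λ y≤x → <⇒≱ c<c′ (cell-mono j y≤x)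

half : ∀ n → n ≡ ⌊ n /2⌋ * 2 ⊎ n ≡ suc (⌊ n /2⌋ * 2)
half zero          = inj₁ refl
half (suc zero)    = inj₂ refl
half (suc (suc n)) = ⊎-map (cong (2 +_)) (cong (2 +_)) (half n)

half-lower : ∀ n → ⌊ n /2⌋ * 2 ≤ n
half-lower n with half n
... | inj₁ eq = ≤-reflexive (sym eq)
... | inj₂ eq = ≤-trans (n≤1+n _) (≤-reflexive (sym eq))

half-upper : ∀ n → n < suc ⌊ n /2⌋ * 2
half-upper n with half n
... | inj₁ eq = s≤s (≤-trans (≤-reflexive eq) (n≤1+n _))
... | inj₂ eq = s≤s (≤-reflexive eq)

half-< : ∀ {n m} → n < 2 * m → ⌊ n /2⌋ < m
half-< {n} {m} n<2m = *-cancelʳ-< 2 ⌊ n /2⌋ m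
  (≤-<-trans (half-lower n) (subst (n <_) (*-comm 2 m) n<2m))

-- A strip has just two halves, `2 * h` and `2 * h + 1`.
siblings-adjacent : ∀ {c c′} → c < c′ → ⌊ c /2⌋ ≡ ⌊ c′ /2⌋ → suc c ≡ c′
siblings-adjacent {c} {c′} c<c′ eq = ≤-antisym c<c′ (s≤s⁻¹ (begin
  suc c′              ≤⟨ half-upper c′ ⟩
  suc ⌊ c′ /2⌋ * 2    ≡⟨ cong (λ h → suc h * 2) eq ⟨
  2 + ⌊ c /2⌋ * 2     ≤⟨ s≤s (s≤s (half-lower c)) ⟩
  2 + c               ∎))
  where open ≤-Reasoning

cell-< : ∀ j m {x} → x < 2 ^ (j + m) → cell j x < 2 ^ m
cell-< zero    m x< = x<
cell-< (suc j) m {x} x< = half-< (cell-< j (suc m) (subst (λ e → x < 2 ^ e) (sym (+-suc j m)) x<))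

-- Strip `c` of level `j` consists of the ranks from `c * 2 ^ j` up to but excluding
-- `suc c * 2 ^ j`, so its `up` line is the `down` line of the next strip.
line : Dir → ℕ → ℕ → ℕ
line up   j c = suc c * 2 ^ j
line down j c = c * 2 ^ j

module _ {f : ℕ → ℚ} (f-mono : ∀ {i j} → i ≤ j → f i ℚ.≤ f j) where

  line-start : ∀ d x → f x ≤[ d ] f (line d 0 x)
  line-start up   x = f-mono (≤-trans (n≤1+n x) (≤-reflexive (sym (*-identityʳ (suc x)))))
  line-start down x = f-mono (≤-reflexive (*-identityʳ x))

  -- The enclosing strip contains the strip, so its boundary lies weakly further out on either side.
  line-coarsen : ∀ d j c → f (line d j c) ≤[ d ] f (line d (suc j) ⌊ c /2⌋)
  line-coarsen up   j c = f-mono (≤-trans (*-monoˡ-≤ (2 ^ j) (half-upper c))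
                                         (≤-reflexive (*-assoc (suc ⌊ c /2⌋) 2 (2 ^ j))))
  line-coarsen down j c = f-mono (≤-trans (≤-reflexive (sym (*-assoc ⌊ c /2⌋ 2 (2 ^ j))))
                                         (*-monoˡ-≤ (2 ^ j) (half-lower c)))

  line-gap : ∀ d j {c c′} → directed _<_ d c c′ → f (line d j c) ≤[ d ] f (line (opp d) j c′)
  line-gap up   j c<c′ = f-mono (*-monoˡ-≤ (2 ^ j) c<c′)
  line-gap down j c′<c = f-mono (*-monoˡ-≤ (2 ^ j) c′<c)

-- Distinct halves of one strip are adjacent, so their facing boundaries are the same line.
line-meet : ∀ d j {c c′} → directed _<_ d c c′ → ⌊ c /2⌋ ≡ ⌊ c′ /2⌋ → line d j c ≡ line (opp d) j c′
line-meet up   j c<c′ eq = cong (_* 2 ^ j) (siblings-adjacent c<c′ eq)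
line-meet down j c′<c eq = cong (_* 2 ^ j) (sym (siblings-adjacent c′<c (sym eq)))

direction : ∀ {m n} → m ≢ n → ∃[ d ] directed _<_ d m n
direction {m} {n} m≢n with <-cmp m n
... | tri< m<n _ _ = up , m<n
... | tri≈ _ m≡n _ = contradiction m≡n m≢n
... | tri> _ _ n<m = down , n<m

-- The network and its size.

length-concat-applyUpTo : ∀ {a} {A : Set a} (g : ℕ → List A) n →
                          length (concat (applyUpTo g n)) ≡ sumTo n (length ∘ g)
length-concat-applyUpTo g zero    = refl
length-concat-applyUpTo g (suc n) =
  trans (length-++ (g 0)) (cong (length (g 0) +_) (length-concat-applyUpTo (g ∘ suc) n))

module Network (X : List Point) (xr : Ranking (map xc X)) (yr : Ranking (map yc X)) where
  open Ranking xr renaming (rank to rankˣ; value to ξ; value-mono to ξ-mono)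
    using (value-rank; rank-<)
  open Ranking yr renaming (rank to rankʸ; value to η; value-mono to η-mono)
    using ()

  col row : ℕ → Point → ℕ
  col j p = cell j (rankˣ (xc p))
  row j p = cell j (rankʸ (yc p))

  ξ-rank : ∀ {p} → p ∈ X → ξ (col 0 p) ≡ xc p
  ξ-rank p∈ = value-rank (∈-map⁺ xc p∈)

  η-rank : ∀ {p} → p ∈ X → η (row 0 p) ≡ yc p
  η-rank p∈ = Ranking.value-rank yr (∈-map⁺ yc p∈)

  Occupied : ℕ → ℕ → ℕ → Set
  Occupied j I J = Any (λ p → col j p ≡ I × row j p ≡ J) X

  occupied? : ∀ j I J → Dec (Occupied j I J)
  occupied? j I J = Any.any? (λ p → (col j p ≟ I) ×-dec (row j p ≟ J)) X

  corner elbow : ℕ → ℕ → ℕ → Dir × Dir → Point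
  corner j I J (dx , dy) = ξ (line dx j I) , η (line dy j J)
  -- An elbow joins a corner of a cell to the corresponding corner of the enclosing cell.
  elbow  j I J (dx , dy) = ξ (line dx (suc j) ⌊ I /2⌋) , η (line dy j J)

  quadrants : List (Dir × Dir)
  quadrants = (up , up) ∷ (up , down) ∷ (down , up) ∷ (down , down) ∷ []

  ∈-quadrants : ∀ q → q ∈ quadrants
  ∈-quadrants (up   , up)   = here refl
  ∈-quadrants (up   , down) = there (here refl)
  ∈-quadrants (down , up)   = there (there (here refl))
  ∈-quadrants (down , down) = there (there (there (here refl)))

  cellPoints : ∀ j I J → Dec (Occupied j I J) → List Point
  cellPoints j I J (yes _) = map (corner j I J) quadrants ++ map (elbow j I J) quadrants
  cellPoints j I J (no  _) = []

  levelPoints : ℕ → ℕ → List Point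
  levelPoints j n = concat (applyUpTo (λ I →
    concat (applyUpTo (λ J → cellPoints j I J (occupied? j I J)) n)) n)

  -- The levels j, ..., j + m, where level j + i has 2 ^ (m - i) strips in each direction.
  network : ℕ → ℕ → List Point
  network zero    j = levelPoints j (2 ^ zero)
  network (suc m) j = levelPoints j (2 ^ suc m) ++ network m (suc j)

  length-cellPoints : ∀ j I J (o : Dec (Occupied j I J)) → length (cellPoints j I J o) ≡ 8 * ⟦ o ⟧
  length-cellPoints j I J (yes _) = refl
  length-cellPoints j I J (no  _) = refl

  length-levelPoints : ∀ j n → length (levelPoints j n) ≡ 8 * ones (occupied? j) n
  length-levelPoints j n = trans
    (trans (length-concat-applyUpTo (λ I → concat (applyUpTo (cells I) n)) n)
           (sumTo-cong n (λ I → trans (length-concat-applyUpTo (cells I) n)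
                                      (sumTo-cong n (λ J → length-cellPoints j I J (occupied? j I J))))))
    (sumGrid-*ˡ n 8 (λ I J → ⟦ occupied? j I J ⟧))
    where
    cells : ℕ → ℕ → List Point
    cells I J = cellPoints j I J (occupied? j I J)

  level-≤ : ∀ c → (∀ j n → ones (occupied? j) n ≤ c * n) →
            ∀ j n → length (levelPoints j n) ≤ 8 * (c * n)
  level-≤ c few j n = ≤-trans (≤-reflexive (length-levelPoints j n)) (*-monoʳ-≤ 8 (few j n))

  -- Each occupied cell gives 8 points, and the strip counts `2 ^ m`, ..., 2, 1 form a geometric
  -- series with sum below `2 * 2 ^ m`; hence the 16.
  length-network : ∀ c → (∀ j n → ones (occupied? j) n ≤ c * n) →
                   ∀ m j → length (network m j) ≤ 16 * c * 2 ^ m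
  length-network c few zero j = begin
    length (levelPoints j 1)        ≤⟨ level-≤ c few j 1 ⟩
    8 * (c * 1)                     ≤⟨ m≤m+n _ (8 * (c * 1)) ⟩
    8 * (c * 1) + 8 * (c * 1)       ≡⟨ double c 1 ⟩
    16 * c * 1                      ∎
    where
    open ≤-Reasoning
    double : ∀ c n → 8 * (c * n) + 8 * (c * n) ≡ 16 * c * n
    double = solve-∀
  length-network c few (suc m) j = begin
    length (levelPoints j (2 ^ suc m) ++ network m (suc j))
      ≡⟨ length-++ (levelPoints j (2 ^ suc m)) ⟩
    length (levelPoints j (2 ^ suc m)) + length (network m (suc j))
      ≤⟨ +-mono-≤ (level-≤ c few j (2 ^ suc m)) (length-network c few m (suc j)) ⟩
    8 * (c * (2 * 2 ^ m)) + 16 * c * 2 ^ m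
      ≡⟨ geometric c (2 ^ m) ⟩
    16 * c * (2 * 2 ^ m) ∎
    where
    open ≤-Reasoning
    geometric : ∀ c n → 8 * (c * (2 * n)) + 16 * c * n ≡ 16 * c * (2 * n)
    geometric = solve-∀

  levelPoints⊆network : ∀ m j → levelPoints j (2 ^ m) ⊆ network m j
  levelPoints⊆network zero    j = λ p∈ → p∈
  levelPoints⊆network (suc m) j = ∈-++⁺ˡ

  network-⊆ : ∀ j m → network m j ⊆ network (j + m) 0
  network-⊆ zero    m q∈ = q∈
  network-⊆ (suc j) m {q} q∈ = subst (λ e → q ∈ network e 0) (+-suc j m)
    (network-⊆ j (suc m) (∈-++⁺ʳ (levelPoints j (2 ^ suc m)) q∈))

  -- Manhattan paths in the network.

  module _ {p} (p∈ : p ∈ X) where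

    cellPoints-occupied : ∀ j → (o : Dec (Occupied j (col j p) (row j p))) → ∀ q →
      corner j (col j p) (row j p) q ∈ cellPoints j (col j p) (row j p) o ×
      elbow  j (col j p) (row j p) q ∈ cellPoints j (col j p) (row j p) o
    cellPoints-occupied j (yes _) q =
      ∈-++⁺ˡ (∈-map⁺ (corner j (col j p) (row j p)) (∈-quadrants q)) ,
      ∈-++⁺ʳ (map (corner j (col j p) (row j p)) quadrants) (∈-map⁺ (elbow j (col j p) (row j p)) (∈-quadrants q))
    cellPoints-occupied j (no empty) q = contradiction (lose p∈ (refl , refl)) empty

    cellPoints⊆levelPoints : ∀ j n → col j p < n → row j p < n →
      cellPoints j (col j p) (row j p) (occupied? j (col j p) (row j p)) ⊆ levelPoints j n
    cellPoints⊆levelPoints j n col< row< q∈ =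
      ∈-concat⁺′ (∈-concat⁺′ q∈ (∈-applyUpTo⁺ _ row<)) (∈-applyUpTo⁺ _ col<)

  module Connection (L : ℕ) (n≤2ᴸ : length X ≤ 2 ^ L) where

    Y : List Point
    Y = X ++ network L 0

    X⊆Y : X ⊆ Y
    X⊆Y = ∈-++⁺ˡ

    module _ {p} (p∈ : p ∈ X) where

      col-< : ∀ j m → j + m ≡ L → col j p < 2 ^ m
      col-< j m refl = cell-< j m (<-≤-trans (rank-< (∈-map⁺ xc p∈))
        (≤-trans (≤-reflexive (length-map xc X)) n≤2ᴸ))

      row-< : ∀ j m → j + m ≡ L → row j p < 2 ^ m
      row-< j m refl = cell-< j m (<-≤-trans (Ranking.rank-< yr (∈-map⁺ yc p∈))
        (≤-trans (≤-reflexive (length-map yc X)) n≤2ᴸ))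

      corner∈ : ∀ j m → j + m ≡ L → ∀ q → corner j (col j p) (row j p) q ∈ Y
      elbow∈  : ∀ j m → j + m ≡ L → ∀ q → elbow  j (col j p) (row j p) q ∈ Y
      corner∈ j m eq q with refl ← eq = ∈-++⁺ʳ X (network-⊆ j m (levelPoints⊆network m j
        (cellPoints⊆levelPoints p∈ j (2 ^ m) (col-< j m eq) (row-< j m eq)
          (proj₁ (cellPoints-occupied p∈ j (occupied? j _ _) q)))))
      elbow∈ j m eq q with refl ← eq = ∈-++⁺ʳ X (network-⊆ j m (levelPoints⊆network m j
        (cellPoints⊆levelPoints p∈ j (2 ^ m) (col-< j m eq) (row-< j m eq)
          (proj₂ (cellPoints-occupied p∈ j (occupied? j _ _) q)))))

      -- By induction on the level: from the corner of a cell, horizontally to the elbow, then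
      -- vertically to the corner of the enclosing cell, never turning back.
      to-corner : ∀ dx dy j m → j + m ≡ L → Path Y dx dy p (corner j (col j p) (row j p) (dx , dy))
      to-corner dx dy zero m eq =
        -- At level 0 the `down` line of the row passes through `p` itself, so the corner
        -- `(dx , down)` is the bend for either `dy`.
        step (X⊆Y p∈) (corner∈ 0 m eq (dx , down)) (inj₂ same-row)
             (subst (_≤[ dx ] ξ (line dx 0 (col 0 p))) (ξ-rank p∈) (line-start ξ-mono dx (col 0 p)))
             (≤[]-reflexive dy same-row) ◅
        step (corner∈ 0 m eq (dx , down)) (corner∈ 0 m eq (dx , dy)) (inj₁ refl)
             (≤[]-reflexive dx refl)
             (subst (_≤[ dy ] η (line dy 0 (row 0 p))) (cong η (sym (*-identityʳ (row 0 p)))) (line-start η-mono dy (row 0 p))) ◅ ε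
        where
        same-row : yc p ≡ η (line down 0 (row 0 p))
        same-row = trans (sym (η-rank p∈)) (cong η (sym (*-identityʳ (row 0 p))))
      to-corner dx dy (suc j) m eq =
        to-corner dx dy j (suc m) eq′ ◅◅
        step (corner∈ j (suc m) eq′ (dx , dy)) (elbow∈ j (suc m) eq′ (dx , dy)) (inj₂ refl)
             (line-coarsen ξ-mono dx j (col j p)) (≤[]-reflexive dy refl) ◅
        step (elbow∈ j (suc m) eq′ (dx , dy)) (corner∈ (suc j) m eq (dx , dy)) (inj₁ refl)
             (≤[]-reflexive dx refl) (line-coarsen η-mono dy j (row j p)) ◅ ε
        where
        eq′ : j + suc m ≡ L
        eq′ = trans (+-suc j m) eq

    module _ {p q} (p∈ : p ∈ X) (q∈ : q ∈ X) where

      -- If the cells of p and q share a strip one level up, then their facing corners are aligned.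
      connect-at : ∀ j m → j + m ≡ L → col j p ≢ col j q → row j p ≢ row j q →
                   col (suc j) p ≡ col (suc j) q ⊎ row (suc j) p ≡ row (suc j) q →
                   ManhattanPath Y p q
      connect-at j m eq col≢ row≢ same with dx , col< ← direction col≢ | dy , row< ← direction row≢ =
        manhattanPath (X⊆Y p∈)
          (to-corner p∈ dx dy j m eq ◅◅
           step (corner∈ p∈ j m eq (dx , dy)) (corner∈ q∈ j m eq (opp dx , opp dy))
                (⊎-map (cong ξ ∘ line-meet dx j col<) (cong η ∘ line-meet dy j row<) same)
                (line-gap ξ-mono dx j col<) (line-gap η-mono dy j row<) ◅
           back dx dy)
        where
        -- Reversing the path from `q` to its facing corner gives directions opposed twice, which
        -- are transported back.
        back : ∀ dx dy → Path Y dx dy (corner j (col j q) (row j q) (opp dx , opp dy)) q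
        back dx dy = subst₂ (λ ex ey → Path Y ex ey (corner j (col j q) (row j q) (opp dx , opp dy)) q) (opp-opp dx) (opp-opp dy)
          (reversePath (to-corner q∈ (opp dx) (opp dy) j m eq))

      -- Passes to coarser levels until the cells first share a strip. This must happen, because
      -- level `L` has a single column.
      connect-from : ∀ j m → j + m ≡ L → col j p ≢ col j q → row j p ≢ row j q → ManhattanPath Y p q
      connect-from j zero eq col≢ row≢ = contradiction
        (trans (n<1⇒n≡0 (col-< p∈ j 0 eq)) (sym (n<1⇒n≡0 (col-< q∈ j 0 eq)))) col≢
      connect-from j (suc m) eq col≢ row≢ with col (suc j) p ≟ col (suc j) q | row (suc j) p ≟ row (suc j) q
      ... | yes same | _        = connect-at j (suc m) eq col≢ row≢ (inj₁ same)
      ... | no _     | yes same = connect-at j (suc m) eq col≢ row≢ (inj₂ same)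
      ... | no col≢′ | no row≢′ = connect-from (suc j) m (trans (sym (+-suc j m)) eq) col≢′ row≢′

    connect : GeneralPosition X → ∀ {p q} → p ∈ X → q ∈ X → ManhattanPath Y p q
    connect general {p} {q} p∈ q∈ with p ≟ᴾ q
    ... | yes refl = manhattanPath {dx = up} {dy = up} (X⊆Y p∈) ε
    -- General position separates the ranks, so at level 0 the cells share neither a row nor a
    -- column.
    ... | no p≢q with x≢ , y≢ ← general p∈ q∈ p≢q = connect-from p∈ q∈ 0 L refl
      (λ eq → x≢ (trans (sym (ξ-rank p∈)) (trans (cong ξ eq) (ξ-rank q∈))))
      (λ eq → y≢ (trans (sym (η-rank p∈)) (trans (cong η eq) (η-rank q∈))))

  -- Occupied cells inherit avoidance of the pattern.

  module _ (general : GeneralPosition X) {p q} (p∈ : p ∈ X) (q∈ : q ∈ X) where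

    -- Monotonicity of `ξ` gives only a weak inequality; general position excludes equality.
    col-<⇒xc-< : ∀ j → col j p < col j q → xc p ℚ.< xc q
    col-<⇒xc-< j lt = ℚ.≰⇒> λ xq≤xp → proj₁ (general p∈ q∈ p≢q) (ℚ.≤-antisym xp≤xq xq≤xp)
      where
      p≢q : p ≢ q
      p≢q refl = <-irrefl refl lt
      xp≤xq : xc p ℚ.≤ xc q
      xp≤xq = subst₂ ℚ._≤_ (ξ-rank p∈) (ξ-rank q∈) (ξ-mono (<⇒≤ (cell-cancel-< j lt)))

    row-<⇒yc-< : ∀ j → row j p < row j q → yc p ℚ.< yc q
    row-<⇒yc-< j lt = ℚ.≰⇒> λ yq≤yp → proj₂ (general p∈ q∈ p≢q) (ℚ.≤-antisym yp≤yq yq≤yp)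
      where
      p≢q : p ≢ q
      p≢q refl = <-irrefl refl lt
      yp≤yq : yc p ℚ.≤ yc q
      yp≤yq = subst₂ ℚ._≤_ (η-rank p∈) (η-rank q∈) (η-mono (<⇒≤ (cell-cancel-< j lt)))

  occupied-avoid : ∀ {k} {π : Permutation′ k} → GeneralPosition X → Avoids π X →
                   ∀ j → ¬ MatrixContains (π ⟨$⟩ʳ_) (Occupied j)
  occupied-avoid {k} general avoids j (u , v , occ , v↑ , u↑) = avoids
    ( point , point∈
    , (λ i i′ lt → row-<⇒yc-< general (point∈ i) (point∈ i′) j
        (subst₂ _<_ (sym (point-row i)) (sym (point-row i′)) (v↑ i i′ lt)))
    , (λ i i′ lt → col-<⇒xc-< general (point∈ i) (point∈ i′) j
        (subst₂ _<_ (sym (point-col i)) (sym (point-col i′)) (u↑ i i′ lt))))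
    where
    point : Fin k → Point
    point i = proj₁ (find (occ i))
    point∈ : ∀ i → point i ∈ X
    point∈ i = proj₁ (proj₂ (find (occ i)))
    point-col : ∀ i → col j (point i) ≡ u i
    point-col i = proj₁ (proj₂ (proj₂ (find (occ i))))
    point-row : ∀ i → row j (point i) ≡ v i
    point-row i = proj₂ (proj₂ (proj₂ (find (occ i))))

-- The linear bound.

LinearNetwork : ℕ → List Point → Set
LinearNetwork c X = Σ (List Point) λ Y →
  Unique Y × IsManhattanNetwork X Y × (length Y ≤ c * length X)

linearNetwork : ∀ {k} (π : Permutation′ k) → 0 < k → ∃[ c ]
  (∀ X → 1 ≤ length X → GeneralPosition X → Avoids π X → LinearNetwork c X)
linearNetwork π 0<k with c , few ← marcusTardos (π ⟨$⟩ʳ_) 0<k =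
  -- The 1 counts `X` itself; the network has at most `16 * c * 2 ^ L` points, and `2 ^ L` is at
  -- most twice the size of `X`.
  1 + 32 * c , construct
  where
  total : ∀ c n → n + 16 * c * (2 * n) ≡ (1 + 32 * c) * n
  total = solve-∀

  construct : ∀ X → 1 ≤ length X → GeneralPosition X → Avoids π X → LinearNetwork (1 + 32 * c) X
  construct X nonempty general avoids
    with L , n≤2ᴸ , 2ᴸ≤2n ← power-above 2 (length X) ≤-refl nonempty =
    -- Neighbouring cells can share corners, so `Y` may list points repeatedly.
    deduplicate _≟ᴾ_ Y , deduplicate-! _≟ᴾ_ Y ,
    ((λ p∈ → ∈-deduplicate⁺ _≟ᴾ_ (X⊆Y p∈)) ,
     (λ p∈ q∈ → ManhattanPath-mono (∈-deduplicate⁺ _≟ᴾ_) (connect general p∈ q∈))) ,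
    (begin
      length (deduplicate _≟ᴾ_ Y)          ≤⟨ length-deduplicate _≟ᴾ_ Y ⟩
      length Y                             ≡⟨ length-++ X ⟩
      length X + length (network L 0)
        ≤⟨ +-monoʳ-≤ (length X) (length-network c few-cells L 0) ⟩
      length X + 16 * c * 2 ^ L            ≤⟨ +-monoʳ-≤ (length X) (*-monoʳ-≤ (16 * c) 2ᴸ≤2n) ⟩
      length X + 16 * c * (2 * length X)   ≡⟨ total c (length X) ⟩
      (1 + 32 * c) * length X              ∎)
    where
    open Network X (ranking (map xc X)) (ranking (map yc X))
    open Connection L n≤2ᴸ
    open ≤-Reasoning
    few-cells : ∀ j n → ones (occupied? j) n ≤ c * n
    few-cells j = few (occupied? j) (occupied-avoid {π = π} general avoids j)

-- Choosing `L` with `power-above` requires a point; the empty set is its own network.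
allow-empty : ∀ {k c} {π : Permutation′ k} →
  (∀ X → 1 ≤ length X → GeneralPosition X → Avoids π X → LinearNetwork c X) →
  ∀ X → Unique X → GeneralPosition X → Avoids π X → LinearNetwork c X
allow-empty network []        _ _       _      = [] , [] , ((λ p∈ → p∈) , λ ()) , z≤n
allow-empty network X@(_ ∷ _) _ general avoids = network X (s≤s z≤n) general avoids

theorem15 : (k : ℕ) (π : Permutation′ k) →
    Σ ℕ λ c →
    (X : List Point) → Unique X → GeneralPosition X → Avoids π X →
    Σ (List Point) λ Y →
    Unique Y × IsManhattanNetwork X Y × (length Y ≤ c * length X)
-- The empty pattern occurs in every set, so no set avoids it.
theorem15 zero π = 0 , λ X _ _ avoids →
  contradiction ((λ ()) , (λ ()) , (λ ()) , (λ ())) avoids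
theorem15 (suc k) π = map₂ (λ {c} → allow-empty {c = c} {π}) (linearNetwork π z<s)
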